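{- Let $T$ be the $d$-regular rooted tree and let $G\le\mathrm{Aut}(T)$ be a martingale virtually mixing group with mixing subgroup $H$. If in every coset $S$ of $G/H$ there exists an element $s\in S$ that fixes infinitely many ends of $T$, then $$\mathrm{FPP}(G)=0.$$
   Context: $T$ is the rooted tree whose vertices are the finite words over $\{1,\dots,d\}$, $d\ge 2$ (root: empty word; $v$ adjacent to $vx$). $|v|$ is word length and $\mathcal L_n$ the set of words of length $n$. $\mathrm{Aut}(T)$ is the group of rooted tree automorphisms; $\pi_n$ denotes restriction of the action to the first $n$ levels. An end is an infinite simple path starting at the root. The section $g|_v$ is defined by $g(vw)=g(v)\,g|_v(w)$. For $G\le \mathrm{Aut}(T)$: $\mathrm{st}_G(v)$ is the stabilizer of $v$, $\mathrm{St}_G(n)=\bigcap_{v\in\mathcal L_n}\mathrm{st}_G(v)$, and for $H\le G$, $H_v=\{h|_v: h\in H,\ h(v)=v\}$. $G$ is self-similar if $g|_v\in G$ for all $g\in G$, $v\in T$; fractal if it is self-similar, transitive on every level, and $G_v=G$ for all $v$. $G$ is a martingale group if for all $n\ge1$ and $v\in\mathcal L_n$, $\mathrm{St}_G(n)$ acts transitively on each level of the subtree $T_v=\{vw\}$. A fractal $G$ is virtually mixing if there are $N\ge0$ (a delay constant) and a finite-index subgroup $H\le G$ (a mixing subgroup) with $H\le \mathrm{St}_G(n)_v$ for all $n\ge1$ and all $v$ with $|v|\ge n+N$. The fixed-point proportion of $G$ is $$\mathrm{FPP}(G)=\lim_{n\to\infty}\frac{\#\{g\in\pi_n(G): g\text{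 fixes at least one vertex in }\mathcal L_n\}}{|\pi_n(G)|}$$ (the limit always exists; for closed $G$ it is the Haar probability of the set of elements fixing at least one vertex at every level). -}

module Defs where

open import Algebra.Bundles using (Group)
import Algebra.Properties.Group as GroupProperties
open import Data.Empty using (⊥-elim)
open import Data.Fin.Base using (Fin)
open import Data.Integer.Base using (+_)
open import Data.List.Base using (List; []; _∷_; _∷ʳ_; _++_; length; drop)
open import Data.List.Properties
  using (++-assoc; ++-cancelˡ; ++-identityʳ; ∷ʳ-++; ∷ʳ-injectiveˡ; length-++)
open import Data.List.Reverse using (Reverse; []; _∶_∶ʳ_; reverseView)
open import Data.Nat.Base using (ℕ; zero; suc; _+_; _≤_; NonZero)
open import Data.Nat.Properties using (m≢1+m+n)
open import Data.Product.Base using (Σ-syntax; ∃; ∃-syntax; _×_; _,_; proj₁; proj₂)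
open import Data.Rational.Base as ℚ using (ℚ; 0ℚ)
open import Data.Sum.Base using (_⊎_; inj₁; inj₂)
open import Function.Bundles using (Inverse; _↔_; mk↔ₛ′; _⇔_; mk⇔; Equivalence)
import Function.Construct.Composition as Composition
import Function.Construct.Identity as Identity
import Function.Construct.Symmetry as Symmetry
open import Level using (0ℓ)
open import Relation.Binary.Bundles using (Setoid)
import Relation.Binary.Construct.On as On
open import Relation.Binary.PropositionalEquality
  using (_≡_; refl; sym; trans; cong; subst; subst₂; setoid; module ≡-Reasoning)
open import Relation.Nullary.Negation.Core using (¬_)
open import Relation.Unary using (Pred; _∈_; _⊆_; _≐_; _∩_)

HasCardinality : Setoid 0ℓ 0ℓ → ℕ → Set
HasCardinality S m = Inverse S (setoid (Fin m))

Finite : Setoid 0ℓ 0ℓ → Set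
Finite S = ∃ (HasCardinality S)

Infinite : Setoid 0ℓ 0ℓ → Set
Infinite S = ¬ Finite S

Word : ℕ → Set
Word d = List (Fin d)

Adjacent : ∀ {d} → Word d → Word d → Set
Adjacent v w = (∃[ x ] w ≡ v ∷ʳ x) ⊎ (∃[ x ] v ≡ w ∷ʳ x)

record Aut (d : ℕ) : Set where
  field
    permutation : Word d ↔ Word d

  open Inverse permutation public using (to; from; inverseˡ; inverseʳ)

  field
    root     : to [] ≡ []
    adjacent : ∀ {v w} → Adjacent v w ⇔ Adjacent (to v) (to w)

infixr 20 _⟨_⟩

_⟨_⟩ : ∀ {d} → Aut d → Word d → Word d
g ⟨ v ⟩ = Aut.to g v

module _ {d : ℕ} where

  to∘from : (g : Aut d) → ∀ v → g ⟨ Aut.from g v ⟩ ≡ v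
  to∘from g v = Aut.inverseˡ g refl

  from∘to : (g : Aut d) → ∀ v → Aut.from g (g ⟨ v ⟩) ≡ v
  from∘to g v = Aut.inverseʳ g refl

  to-injective : (g : Aut d) → ∀ {v w} → g ⟨ v ⟩ ≡ g ⟨ w ⟩ → v ≡ w
  to-injective g {v} {w} eq =
    trans (sym (from∘to g v)) (trans (cong (Aut.from g) eq) (from∘to g w))

  idᴬ : Aut d
  idᴬ = record
    { permutation = Identity.↔-id _
    ; root        = refl
    ; adjacent    = Identity.⇔-id _
    }

  infixl 7 _∙ᴬ_

  _∙ᴬ_ : Aut d → Aut d → Aut d
  g ∙ᴬ h = record
    { permutation = Composition._↔-∘_ (Aut.permutation g) (Aut.permutation h)
    ; root        = trans (cong (Aut.to g) (Aut.root h)) (Aut.root g)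
    ; adjacent    = Composition._⇔-∘_ (Aut.adjacent g) (Aut.adjacent h)
    }

  infix 8 _⁻¹ᴬ

  _⁻¹ᴬ : Aut d → Aut d
  g ⁻¹ᴬ = record
    { permutation = Symmetry.↔-sym (Aut.permutation g)
    ; root        = trans (cong (Aut.from g) (sym (Aut.root g))) (from∘to g [])
    ; adjacent    = λ {v} {w} → mk⇔
        (λ a → Equivalence.from (Aut.adjacent g)
                 (subst₂ Adjacent (sym (to∘from g v)) (sym (to∘from g w)) a))
        (λ a → subst₂ Adjacent (to∘from g v) (to∘from g w)
                 (Equivalence.to (Aut.adjacent g) a))
    }

autGroup : ℕ → Group 0ℓ 0ℓ
autGroup d = record
  { Carrier = Aut d
  ; _≈_     = λ g h → ∀ v → g ⟨ v ⟩ ≡ h ⟨ v ⟩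
  ; _∙_     = _∙ᴬ_
  ; ε       = idᴬ
  ; _⁻¹     = _⁻¹ᴬ
  ; isGroup = record
    { isMonoid = record
      { isSemigroup = record
        { isMagma = record
          { isEquivalence = record
            { refl  = λ _ → refl
            ; sym   = λ p v → sym (p v)
            ; trans = λ p q v → trans (p v) (q v)
            }
          ; ∙-cong = λ {g} {g′} {h} {h′} p q v → trans (cong (Aut.to g) (q v)) (p (h′ ⟨ v ⟩))
          }
        ; assoc = λ _ _ _ _ → refl
        }
      ; identity = (λ _ _ → refl) , (λ _ _ → refl)
      }
    ; inverse = (λ g v → from∘to g v) , (λ g v → to∘from g v)
    ; ⁻¹-cong = λ {g} {h} p v → to-injective g
        (trans (to∘from g v)
          (trans (sym (to∘from h v)) (sym (p (Aut.from h v)))))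
    }
  }

module _ {d : ℕ} where

  private
    []≢∷ʳ : ∀ (v : Word d) {x} → ¬ [] ≡ v ∷ʳ x
    []≢∷ʳ []      ()
    []≢∷ʳ (_ ∷ _) ()

    ≢-snoc² : ∀ (v : Word d) {x y} → ¬ v ≡ v ∷ʳ x ∷ʳ y
    ≢-snoc² v {x} {y} eq = m≢1+m+n (length v) (trans (cong length eq) lem)
      where
      lem : length (v ∷ʳ x ∷ʳ y) ≡ suc (length v + 1)
      lem = trans (cong length (∷ʳ-++ v x (y ∷ [])))
              (trans (length-++ v) (aux (length v)))
        where
        aux : ∀ n → n + 2 ≡ suc (n + 1)
        aux zero    = refl
        aux (suc n) = cong suc (aux n)

    drop-length-++ : ∀ (v w : Word d) → drop (length v) (v ++ w) ≡ w
    drop-length-++ []      w = refl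
    drop-length-++ (_ ∷ v) w = drop-length-++ v w

  to-∷ʳ : (g : Aut d) → ∀ v x → ∃[ y ] g ⟨ v ∷ʳ x ⟩ ≡ g ⟨ v ⟩ ∷ʳ y
  to-∷ʳ g v x = go (reverseView v) x
    where
    go : ∀ {v} → Reverse v → ∀ x → ∃[ y ] g ⟨ v ∷ʳ x ⟩ ≡ g ⟨ v ⟩ ∷ʳ y
    go {v} r x with Equivalence.to (Aut.adjacent g {v} {v ∷ʳ x}) (inj₁ (x , refl))
    go r              x | inj₁ child    = child
    go []             x | inj₂ (y , eq) = ⊥-elim ([]≢∷ʳ _ (trans (sym (Aut.root g)) eq))
    go (u ∶ r ∶ʳ z) x | inj₂ (y , eq) = ⊥-elim (≢-snoc² u (to-injective g
      (∷ʳ-injectiveˡ (g ⟨ u ⟩) _ (trans (sym (proj₂ (go r z))) eq))))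

  length-to : (g : Aut d) → ∀ v → length (g ⟨ v ⟩) ≡ length v
  length-to g v = go (reverseView v)
    where
    go : ∀ {v} → Reverse v → length (g ⟨ v ⟩) ≡ length v
    go []             = cong length (Aut.root g)
    go (u ∶ r ∶ʳ x) = trans (cong length (proj₂ (to-∷ʳ g u x)))
      (trans (length-++ (g ⟨ u ⟩)) (trans (cong (_+ 1) (go r)) (sym (length-++ u))))

  to-++ : (g : Aut d) → ∀ v w → g ⟨ v ++ w ⟩ ≡ g ⟨ v ⟩ ++ drop (length v) (g ⟨ v ++ w ⟩)
  to-++ g v w with extension v w
    where
    extension : ∀ v w → ∃[ u ] g ⟨ v ++ w ⟩ ≡ g ⟨ v ⟩ ++ u
    extension v []      = [] , trans (cong (Aut.to g) (++-identityʳ v)) (sym (++-identityʳ _))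
    extension v (x ∷ w) with to-∷ʳ g v x | extension (v ∷ʳ x) w
    ... | y , p | u , q = y ∷ u ,
      trans (cong (Aut.to g) (sym (∷ʳ-++ v x w)))
        (trans q (trans (cong (_++ u) p) (∷ʳ-++ (g ⟨ v ⟩) y u)))
  ... | u , p = trans p (cong (g ⟨ v ⟩ ++_) (sym (trans (cong (drop (length v)) p)
      (subst (λ k → drop k (g ⟨ v ⟩ ++ u) ≡ u) (length-to g v) (drop-length-++ (g ⟨ v ⟩) u)))))

  adjacent-++ : ∀ v {w w′ : Word d} → Adjacent w w′ ⇔ Adjacent (v ++ w) (v ++ w′)
  adjacent-++ v {w} {w′} = mk⇔
    (λ { (inj₁ (x , p)) → inj₁ (x , trans (cong (v ++_) p) (sym (++-assoc v w _)))
       ; (inj₂ (x , p)) → inj₂ (x , trans (cong (v ++_) p) (sym (++-assoc v w′ _))) })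
    (λ { (inj₁ (x , p)) → inj₁ (x , ++-cancelˡ v _ _ (trans p (++-assoc v w _)))
       ; (inj₂ (x , p)) → inj₂ (x , ++-cancelˡ v _ _ (trans p (++-assoc v w′ _))) })

  section : Aut d → Word d → Aut d
  section g v = record
    { permutation = mk↔ₛ′ f f⁻¹ f∘f⁻¹ f⁻¹∘f
    ; root        = ++-cancelˡ (g ⟨ v ⟩) _ _ (trans (sym (to-++ g v []))
                      (trans (cong (Aut.to g) (++-identityʳ v)) (sym (++-identityʳ _))))
    ; adjacent    = λ {w} {w′} → mk⇔
        (λ a → Equivalence.from (adjacent-++ (g ⟨ v ⟩))
                 (subst₂ Adjacent (to-++ g v w) (to-++ g v w′)
                   (Equivalence.to (Aut.adjacent g) (Equivalence.to (adjacent-++ v) a))))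
        (λ a → Equivalence.from (adjacent-++ v) (Equivalence.from (Aut.adjacent g)
                 (subst₂ Adjacent (sym (to-++ g v w)) (sym (to-++ g v w′))
                   (Equivalence.to (adjacent-++ (g ⟨ v ⟩)) a))))
    }
    where
    f f⁻¹ : Word d → Word d
    f   w = drop (length v) (g ⟨ v ++ w ⟩)
    f⁻¹ w = drop (length v) (Aut.from g (g ⟨ v ⟩ ++ w))

    from-++ : ∀ w → Aut.from g (g ⟨ v ⟩ ++ w) ≡ v ++ f⁻¹ w
    from-++ w = begin
      Aut.from g (g ⟨ v ⟩ ++ w)
        ≡⟨ to-++ (g ⁻¹ᴬ) (g ⟨ v ⟩) w ⟩
      Aut.from g (g ⟨ v ⟩) ++ drop (length (g ⟨ v ⟩)) (Aut.from g (g ⟨ v ⟩ ++ w))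
        ≡⟨ cong (_++ drop (length (g ⟨ v ⟩)) (Aut.from g (g ⟨ v ⟩ ++ w))) (from∘to g v) ⟩
      v ++ drop (length (g ⟨ v ⟩)) (Aut.from g (g ⟨ v ⟩ ++ w))
        ≡⟨ cong (λ k → v ++ drop k (Aut.from g (g ⟨ v ⟩ ++ w))) (length-to g v) ⟩
      v ++ f⁻¹ w ∎
      where open ≡-Reasoning

    f∘f⁻¹ : ∀ w → f (f⁻¹ w) ≡ w
    f∘f⁻¹ w = ++-cancelˡ (g ⟨ v ⟩) _ _ (trans (sym (to-++ g v (f⁻¹ w)))
      (trans (cong (Aut.to g) (sym (from-++ w))) (to∘from g _)))

    f⁻¹∘f : ∀ w → f⁻¹ (f w) ≡ w
    f⁻¹∘f w = ++-cancelˡ v _ _ (trans (sym (from-++ (f w)))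
      (trans (cong (Aut.from g) (sym (to-++ g v w))) (from∘to g _)))

  section-++ : (g : Aut d) → ∀ v w → g ⟨ v ++ w ⟩ ≡ g ⟨ v ⟩ ++ section g v ⟨ w ⟩
  section-++ = to-++

record Subgroup (d : ℕ) : Set₁ where
  open Group (autGroup d) using (_≈_; _∙_; ε; _⁻¹)
  field
    Member    : Pred (Aut d) 0ℓ
    respects  : ∀ {g h} → g ≈ h → g ∈ Member → h ∈ Member
    ε-closed  : ε ∈ Member
    ∙-closed  : ∀ {g h} → g ∈ Member → h ∈ Member → g ∙ h ∈ Member
    ⁻¹-closed : ∀ {g} → g ∈ Member → g ⁻¹ ∈ Member

open Subgroup public using (Member)

module _ {d : ℕ} where

  open Group (autGroup d) using (_≈_; _∙_; _⁻¹)

  LeftCoset : Subgroup d → Aut d → Pred (Aut d) 0ℓ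
  LeftCoset H g s = g ⁻¹ ∙ s ∈ Member H

  cosets : (G H : Subgroup d) → Setoid 0ℓ 0ℓ
  cosets G H = record
    { Carrier       = ∃ (Member G)
    ; _≈_           = λ (g , _) (s , _) → s ∈ LeftCoset H g
    ; isEquivalence = record
      { refl  = λ {(g , _)} → respects (λ v → sym (from∘to g v)) ε-closed
      ; sym   = λ {(g , _)} {(s , _)} p →
          respects (λ v → trans (⁻¹-anti-homo-∙ (g ⁻¹) s v)
                             (cong (Aut.to (s ⁻¹)) (⁻¹-involutive g v)))
                   (⁻¹-closed p)
      ; trans = λ {(g , _)} {(s , _)} {(t , _)} p q →
          respects (λ v → cong (Aut.to (g ⁻¹)) (to∘from s (t ⟨ v ⟩))) (∙-closed p q)
      }
    }
    where
    open Subgroup H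
    open GroupProperties (autGroup d) using (⁻¹-anti-homo-∙; ⁻¹-involutive)

  FiniteIndex : (G H : Subgroup d) → Set
  FiniteIndex G H = Finite (cosets G H)

  LevelStabilizer : Subgroup d → ℕ → Pred (Aut d) 0ℓ
  LevelStabilizer G n g = g ∈ Member G × (∀ v → length v ≡ n → g ⟨ v ⟩ ≡ v)

  SectionsAt : Pred (Aut d) 0ℓ → Word d → Pred (Aut d) 0ℓ
  SectionsAt H v k = ∃[ h ] h ∈ H × h ⟨ v ⟩ ≡ v × section h v ≈ k

  SelfSimilar : Subgroup d → Set
  SelfSimilar G = ∀ {g} → g ∈ Member G → ∀ v → section g v ∈ Member G

  LevelTransitive : Subgroup d → Set
  LevelTransitive G = ∀ v w → length v ≡ length w → ∃[ g ] g ∈ Member G × g ⟨ v ⟩ ≡ w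

  record Fractal (G : Subgroup d) : Set where
    field
      selfSimilar     : SelfSimilar G
      levelTransitive : LevelTransitive G
      fullSections    : ∀ v → SectionsAt (Member G) v ≐ Member G

  Martingale : Subgroup d → Set
  Martingale G = ∀ n v → 1 ≤ n → length v ≡ n →
    ∀ w w′ → length w ≡ length w′ →
    ∃[ g ] g ∈ LevelStabilizer G n × g ⟨ v ++ w ⟩ ≡ v ++ w′

  record MixingSubgroup (G H : Subgroup d) : Set where
    field
      subgroup    : Member H ⊆ Member G
      finiteIndex : FiniteIndex G H
      delay       : ℕ
      mixing      : ∀ n v → 1 ≤ n → n + delay ≤ length v →
                    Member H ⊆ SectionsAt (LevelStabilizer G n) v

  record VirtuallyMixing (G : Subgroup d) : Set₁ where
    field
      fractal          : Fractal G
      mixingSubgroup   : Subgroup d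
      isMixingSubgroup : MixingSubgroup G mixingSubgroup

record End (d : ℕ) : Set where
  field
    vertex : ℕ → Word d
    start  : vertex 0 ≡ []
    step   : ∀ n → Adjacent (vertex n) (vertex (suc n))
    simple : ∀ {m n} → vertex m ≡ vertex n → m ≡ n

open End public using (vertex)

ends : ℕ → Setoid 0ℓ 0ℓ
ends d = record
  { Carrier       = End d
  ; _≈_           = λ e e′ → ∀ n → vertex e n ≡ vertex e′ n
  ; isEquivalence = record
    { refl  = λ _ → refl
    ; sym   = λ p n → sym (p n)
    ; trans = λ p q n → trans (p n) (q n)
    }
  }

module _ {d : ℕ} where

  FixesEnd : Aut d → Pred (End d) 0ℓ
  FixesEnd g e = ∀ n → g ⟨ vertex e n ⟩ ≡ vertex e n

  fixedEnds : Aut d → Setoid 0ℓ 0ℓ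
  fixedEnds g = On.setoid (ends d) (proj₁ {B = FixesEnd g})

  FixesInfinitelyManyEnds : Pred (Aut d) 0ℓ
  FixesInfinitelyManyEnds g = Infinite (fixedEnds g)

Converges : (ℕ → ℚ) → ℚ → Set
Converges s r = ∀ ε → 0ℚ ℚ.< ε → ∃[ N ] (∀ n → N ≤ n → ℚ.∣ s n ℚ.- r ∣ ℚ.< ε)

module _ {d : ℕ} where

  agreeUpTo : ℕ → Setoid 0ℓ 0ℓ
  agreeUpTo n = record
    { Carrier       = Aut d
    ; _≈_           = λ g h → ∀ v → length v ≤ n → g ⟨ v ⟩ ≡ h ⟨ v ⟩
    ; isEquivalence = record
      { refl  = λ _ _ → refl
      ; sym   = λ p v l → sym (p v l)
      ; trans = λ p q v l → trans (p v l) (q v l)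
      }
    }

  -- π_n(P), as the elements of P modulo equality of their restrictions to
  -- the first n levels.
  π : ℕ → Pred (Aut d) 0ℓ → Setoid 0ℓ 0ℓ
  π n P = On.setoid (agreeUpTo n) (proj₁ {B = P})

  FixesVertexAtLevel : ℕ → Pred (Aut d) 0ℓ
  FixesVertexAtLevel n g = ∃[ v ] length v ≡ n × g ⟨ v ⟩ ≡ v

  -- Whether g fixes a vertex of level n depends only on its restriction to
  -- the first n levels, so the numerator counts the elements of π_n(G) that
  -- fix such a vertex.
  record FixingProportion (G : Subgroup d) (n : ℕ) (q : ℚ) : Set where
    field
      fixing total        : ℕ
      {{total-nonZero}}   : NonZero total
      fixing-card         : HasCardinality (π n (Member G ∩ FixesVertexAtLevel n)) fixing
      total-card          : HasCardinality (π n (Member G)) total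
      proportion          : q ≡ (+ fixing) ℚ./ total

  -- "FPP(G) exists and equals r"
  HasFPP : Subgroup d → ℚ → Set
  HasFPP G r = Σ[ s ∈ (ℕ → ℚ) ] (∀ n → FixingProportion G n (s n)) × Converges s r

{-# OPTIONS --safe #-}

-- Let X n g be the number of vertices of level n fixed by g.  The martingale
-- condition makes X a (super)martingale on G: its average over a coset of
-- St_G(n) does not increase with the level.  Mixing makes it unlikely to stay
-- small: if g fixes v at depth delay + 1 below level n, then g can be modified
-- inside g St_G(n), keeping v fixed, so that the section at v becomes any
-- element of the H-coset of g|_v; some such element fixes K vertices of level m,
-- where m depends on K only because G/H is finite.  So in a coset containing an
-- element that still fixes a vertex further down, the event X ≥ K happens within
-- L = delay + 1 + m levels with probability at least 1/M, where M does not depend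
-- on n.  By induction on k the probability that g h, h ∈ St_G(n), fixes a vertex
-- of level n + kL is at most (1 - 1/M)^k [X n g < K] + (X n g)/K, and for n = 0
-- this is small when K and then k are large.

module Submission where

open import Defs
open import Axiom.ExcludedMiddle using (ExcludedMiddle)
open import Data.Empty using (⊥-elim)
open import Data.Fin.Base using (Fin; zero; suc; combine; remQuot; funToFin; finToFun; fromℕ<)
open import Data.Fin.Properties using
  (remQuot-combine; combine-remQuot; finToFun-funToFin; nonZeroIndex; pigeonhole)
  renaming (suc-injective to Fin-suc-injective; <⇒≢ to Fin-<⇒≢; 0≢1+n to Fin-0≢1+n)
import Data.Integer.Base as ℤ
import Data.Integer.Properties as ℤ
open import Data.List.Base using ([]; _∷_; _∷ʳ_; _++_; length; take; drop; replicate)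
open import Data.List.Properties using
  ( ++-assoc; ++-cancelˡ; ∷-injective; ∷ʳ-injectiveˡ; length-++; length-replicate
  ; length-take; take++drop≡id; length-drop )
open import Data.Nat.Base using
  ( ℕ; zero; suc; _+_; _*_; _^_; _∸_; _⊓_; _⊔_; _≤_; _<_; z≤n; s≤s; NonZero
  ; >-nonZero; >-nonZero⁻¹ )
open import Data.Nat.Properties
open import Data.Nat.Tactic.RingSolver using (solve-∀)
open import Data.Product.Base using (Σ-syntax; ∃; ∃-syntax; _×_; _,_; proj₁; proj₂)
open import Data.Rational.Base as ℚ using (ℚ; mkℚ; 0ℚ)
import Data.Rational.Properties as ℚ
open import Data.Rational.Unnormalised.Base as ℚᵘ using (mkℚᵘ)
import Data.Rational.Unnormalised.Properties as ℚᵘ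
open import Data.Sum.Base using (inj₁; inj₂)
open import Data.Unit.Base using (⊤; tt)
open import Function.Bundles using (Inverse)
open import Level using (0ℓ)
open import Relation.Binary.Bundles using (Setoid)
open import Relation.Binary.PropositionalEquality using
  (_≡_; refl; sym; trans; cong; cong₂; subst; subst₂; module ≡-Reasoning)
open import Relation.Nullary.Decidable.Core using (Dec; yes; no; decidable-stable)
open import Relation.Nullary.Negation.Core using (¬_)
open import Relation.Unary using (Pred; _∈_; _∩_)
open import Algebra.Properties.Semiring.Sum +-*-semiring using
  (sum; sum-cong-≗; ∑-comm; ∑-distrib-+; *-distribˡ-sum)

-- Finite sums and elementary inequalities.

eventually-all : ∀ {r} (P : Fin r → ℕ → Set) →
  (∀ i → ∃[ m₀ ] (∀ m → m₀ ≤ m → P i m)) →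
  ∃[ m₀ ] (∀ m → m₀ ≤ m → ∀ i → P i m)
eventually-all {zero}  P ev = 0 , λ _ _ ()
eventually-all {suc r} P ev
  with a , p ← ev zero | b , q ← eventually-all (λ i → P (suc i)) (λ i → ev (suc i)) =
  a ⊔ b , λ where
    m le zero    → p m (≤-trans (m≤m⊔n a b) le)
    m le (suc i) → q m (≤-trans (m≤n⊔m a b) le) i

sum-mono : ∀ {n} {f g : Fin n → ℕ} → (∀ i → f i ≤ g i) → sum f ≤ sum g
sum-mono {zero}  le = z≤n
sum-mono {suc n} le = +-mono-≤ (le zero) (sum-mono (λ i → le (suc i)))

sum-const : ∀ n c → sum {n} (λ _ → c) ≡ n * c
sum-const zero    c = refl
sum-const (suc n) c = cong (c +_) (sum-const n c)

term≤sum : ∀ {n} (f : Fin n → ℕ) i → f i ≤ sum f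
term≤sum f zero    = m≤m+n _ _
term≤sum f (suc i) = ≤-trans (term≤sum (λ j → f (suc j)) i) (m≤n+m _ _)

-- The identities from here to `exchange` are the rearrangements in `decay`. They are stated over
-- plain variables, so that the solver meets sums and powers only as atoms.
scale : ∀ s k m p a → s * (k * (m * p) * a) ≡ m * (k * p * (s * a))
scale = solve-∀

spread : ∀ a s c b p x → a * (s * (c * b + p * x)) ≡ s * c * (a * b) + s * p * (a * x)
spread = solve-∀

collect : ∀ m s k q b p x → m * (s * (k * q) * b + s * p * x) ≡ s * (k * q * (m * b) + m * p * x)
collect = solve-∀

factor : ∀ s k q m′ t m p x →
  s * (k * q * (m′ * t) + m * p * (t * x)) ≡ s * (t * (k * (m′ * q) * 1 + m * p * x))
factor = solve-∀

swap-factors : ∀ x p s → x * p * s ≡ s * (p * x)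
swap-factors = solve-∀

exchange : ∀ c a x → c * (a * x) ≡ a * (c * x)
exchange = solve-∀

-- If `c` has a share of at least 1/m′ in `s`, the share left for `b` is at most 1 - 1/m′, hence at
-- most 1 - 1/(m′ + 1); the weaker form avoids subtraction.
complement-bound : ∀ m′ {b c s} → b + c ≤ s → s ≤ m′ * c → suc m′ * b ≤ m′ * s
complement-bound m′ {b} {c} {s} b+c≤s s≤ = +-cancelˡ-≤ s _ _ (begin
  s + suc m′ * b          ≤⟨ +-monoˡ-≤ (suc m′ * b) (≤-trans s≤ (m≤n+m (m′ * c) c)) ⟩
  suc m′ * c + suc m′ * b ≡⟨ sym (*-distribˡ-+ (suc m′) c b) ⟩
  suc m′ * (c + b)        ≤⟨ *-monoʳ-≤ (suc m′) (≤-trans (≤-reflexive (+-comm c b)) b+c≤s) ⟩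
  suc m′ * s              ∎)
  where open ≤-Reasoning

-- Bernoulli's inequality 1 + k/m ≤ (1 + 1/m)^k with denominators cleared.
bernoulli : ∀ m k → m ^ k * (m + k) ≤ m * suc m ^ k
bernoulli m zero    = ≤-reflexive
  (trans (*-identityˡ (m + 0)) (trans (+-identityʳ m) (sym (*-identityʳ m))))
bernoulli m (suc k) = begin
  m * m ^ k * (m + suc k)           ≤⟨ m≤m+n _ (m ^ k * k) ⟩
  m * m ^ k * (m + suc k) + m ^ k * k ≡⟨ expand m (m ^ k) k ⟩
  suc m * (m ^ k * (m + k))         ≤⟨ *-monoʳ-≤ (suc m) (bernoulli m k) ⟩
  suc m * (m * suc m ^ k)           ≡⟨ exchange (suc m) m (suc m ^ k) ⟩
  m * (suc m * suc m ^ k)           ∎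
  where
  open ≤-Reasoning
  expand : ∀ m p k → m * p * (m + suc k) + p * k ≡ suc m * (p * (m + k))
  expand = solve-∀

geometric : ∀ K m .{{_ : NonZero m}} → K * m ^ (K * m) ≤ suc m ^ (K * m)
geometric K m = *-cancelˡ-≤ m (begin
  m * (K * m ^ k)   ≡⟨ rearrange m K (m ^ k) ⟩
  m ^ k * (K * m)   ≤⟨ *-monoʳ-≤ (m ^ k) (m≤n+m k m) ⟩
  m ^ k * (m + k)   ≤⟨ bernoulli m k ⟩
  m * suc m ^ k     ∎)
  where
  open ≤-Reasoning
  k = K * m
  rearrange : ∀ m K p → m * (K * p) ≡ p * (K * m)
  rearrange = solve-∀

-- A positive ε with denominator b is at least 1/b, and the hypothesis bounds f/t by 1/(2b). The
-- spare factor 2 makes the inequality strict.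
fraction-small : ∀ f t .{{_ : NonZero t}} ε → 0ℚ ℚ.< ε → 4 * ℚ.denominatorℕ ε * f ≤ 2 * t →
                 ℚ.∣ (ℤ.+ f) ℚ./ t ℚ.- 0ℚ ∣ ℚ.< ε
fraction-small f t@(suc t-1) (mkℚ (ℤ.+ zero) _ _) (ℚ.*<* (ℤ.+<+ ())) _
fraction-small f t@(suc t-1) ε@(mkℚ (ℤ.+ suc a) b-1 _) _ le =
  subst (ℚ._< ε) (sym (trans (cong ℚ.∣_∣ (ℚ.+-identityʳ (ℤ.+ f ℚ./ t)))
      (ℚ.0≤p⇒∣p∣≡p (ℚ.nonNegative⁻¹ (ℤ.+ f ℚ./ t) {{ℚ.normalize-nonNeg f t}}))))
    (ℚ.toℚᵘ-cancel-< (ℚᵘ.<-respˡ-≃ (ℚᵘ.≃-sym (ℚ.toℚᵘ-fromℚᵘ (mkℚᵘ (ℤ.+ f) t-1)))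
      (ℚᵘ.*<* (subst₂ ℤ._<_ (ℤ.pos-* f b) (ℤ.pos-* (suc a) t) (ℤ.+<+ f*b<)))))
  where
  open ≤-Reasoning
  b = suc b-1

  regroup : ∀ b f → 2 * (2 * (f * b)) ≡ 4 * b * f
  regroup = solve-∀

  f*b< : f * b < suc a * t
  f*b< = *-cancelˡ-< 2 _ _ (begin-strict
    2 * (f * b)      ≤⟨ *-cancelˡ-≤ 2 (≤-trans (≤-reflexive (regroup b f)) le) ⟩
    t                <⟨ m<m+n t (s≤s z≤n) ⟩
    t + (t + 0)      ≤⟨ *-monoʳ-≤ 2 (m≤m+n t (a * t)) ⟩
    2 * (suc a * t)  ∎)

-- Words, the action on the tree, and ends.

module _ {d : ℕ} where

  word : ∀ n → Fin (d ^ n) → Word d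
  word zero    _ = []
  word (suc n) i = proj₁ (remQuot {d} (d ^ n) i) ∷ word n (proj₂ (remQuot {d} (d ^ n) i))

  length-word : ∀ n i → length (word n i) ≡ n
  length-word zero    i = refl
  length-word (suc n) i = cong suc (length-word n _)

  word-injective : ∀ n {i j} → word n i ≡ word n j → i ≡ j
  word-injective zero    {zero} {zero} _ = refl
  word-injective (suc n) {i} {j} eq with p , q ← ∷-injective eq =
    trans (sym (combine-remQuot {d} (d ^ n) i))
      (trans (cong₂ combine p (word-injective n q)) (combine-remQuot {d} (d ^ n) j))

  code : ∀ n (w : Word d) → length w ≡ n → Fin (d ^ n)
  code zero    []      _  = zero
  code (suc n) (x ∷ w) eq = combine x (code n w (suc-injective eq))

  word-code : ∀ n (w : Word d) (eq : length w ≡ n) → word n (code n w eq) ≡ w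
  word-code zero    []      _  = refl
  word-code (suc n) (x ∷ w) eq = trans
    (cong (λ p → proj₁ p ∷ word n (proj₂ p)) (remQuot-combine x (code n w (suc-injective eq))))
    (cong (x ∷_) (word-code n w (suc-injective eq)))

  module _ (m k : ℕ) where

    -- The restriction of `f` to one level as a single number. The size of the target serves twice:
    -- it makes `π n` finite, and it becomes the constant in `large-class`.
    tableCode : (f : Word d → Word d) → (∀ w → length w ≡ m → length (f w) ≡ k) →
                Fin ((d ^ k) ^ (d ^ m))
    tableCode f len = funToFin (λ i → code k (f (word m i)) (len (word m i) (length-word m i)))

    tableCode-injective : ∀ f f′ len len′ → tableCode f len ≡ tableCode f′ len′ →
                          ∀ w → length w ≡ m → f w ≡ f′ w
    tableCode-injective f f′ len len′ eq w ∣w∣ = begin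
      f w          ≡⟨ cong f (sym (word-code m w ∣w∣)) ⟩
      f (word m i) ≡⟨ sym (word-code k _ _) ⟩
      word k (code k (f (word m i)) _)
        ≡⟨ cong (word k) (trans (sym (finToFun-funToFin _ i))
             (trans (cong (λ c → finToFun c i) eq) (finToFun-funToFin _ i))) ⟩
      word k (code k (f′ (word m i)) _) ≡⟨ word-code k _ _ ⟩
      f′ (word m i) ≡⟨ cong f′ (word-code m w ∣w∣) ⟩
      f′ w ∎
      where
      open ≡-Reasoning
      i = code m w ∣w∣

  ++-injective : ∀ (u u′ : Word d) {w w′} → length u ≡ length u′ →
                 u ++ w ≡ u′ ++ w′ → u ≡ u′ × w ≡ w′
  ++-injective []      []       _   eq = refl , eq
  ++-injective (x ∷ u) (y ∷ u′) len eq
    with p , q ← ∷-injective eq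
    with r , s ← ++-injective u u′ (suc-injective len) q = cong₂ _∷_ p r , s

  length-++-≡ : ∀ (v w : Word d) {m n} → length v ≡ m → length w ≡ n → length (v ++ w) ≡ m + n
  length-++-≡ v w p q = trans (length-++ v) (cong₂ _+_ p q)

  split-word : ∀ {m n} (u : Word d) → length u ≡ m + n →
               ∃[ v ] ∃[ w ] u ≡ v ++ w × length v ≡ m × length w ≡ n
  split-word {m} {n} u ∣u∣ = take m u , drop m u , sym (take++drop≡id m u) ,
    trans (length-take m u) (trans (cong (m ⊓_) ∣u∣) (m≤n⇒m⊓n≡m (m≤m+n m n))) ,
    trans (length-drop m u) (trans (cong (_∸ m) ∣u∣) (m+n∸m≡n m n))

  -- With `idᴬ` for `h`, this passes from a fixed word to its fixed prefixes.
  agree-prefix : ∀ (g h : Aut d) v w → g ⟨ v ++ w ⟩ ≡ h ⟨ v ++ w ⟩ → g ⟨ v ⟩ ≡ h ⟨ v ⟩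
  agree-prefix g h v w eq = proj₁ (++-injective (g ⟨ v ⟩) (h ⟨ v ⟩)
    (trans (length-to g v) (sym (length-to h v)))
    (trans (sym (section-++ g v w)) (trans eq (section-++ h v w))))

  -- For nonzero `d` every shorter word extends to level `n`, so this is equality in π_n; inside G
  -- its classes are the cosets g St_G(n).
  Agree : ℕ → Aut d → Aut d → Set
  Agree n g h = ∀ v → length v ≡ n → g ⟨ v ⟩ ≡ h ⟨ v ⟩

  module _ .{{_ : NonZero d}} where

    extend : ∀ {n} (v : Word d) → length v ≤ n → ∃[ w ] length (v ++ w) ≡ n
    extend {n} v le = replicate (n ∸ length v) (fromℕ< (>-nonZero⁻¹ d)) ,
      trans (length-++ v) (trans (cong (length v +_) (length-replicate _)) (m+[n∸m]≡n le))

    agree-≤ : ∀ {n} (g h : Aut d) → Agree n g h → ∀ v → length v ≤ n → g ⟨ v ⟩ ≡ h ⟨ v ⟩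
    agree-≤ g h ag v le with w , eq ← extend v le = agree-prefix g h v w (ag _ eq)

    agree-mono : ∀ {m n} (g h : Aut d) → m ≤ n → Agree n g h → Agree m g h
    agree-mono g h le ag v eq = agree-≤ g h ag v (≤-trans (≤-reflexive eq) le)

  fixes-mono : ∀ {m n} (g : Aut d) → m ≤ n → FixesVertexAtLevel n g → FixesVertexAtLevel m g
  fixes-mono {m} {n} g le (u , ∣u∣ , fix)
    with v , w , refl , ∣v∣ , _ ← split-word {m} {n ∸ m} u (trans ∣u∣ (sym (m+[n∸m]≡n le))) =
    v , ∣v∣ , agree-prefix g idᴬ v w fix

  -- The root has no parent, and a later step to the unique parent would revisit the vertex before
  -- last, which simplicity forbids.
  vertex-suc : ∀ (e : End d) n → ∃[ x ] vertex e (suc n) ≡ vertex e n ∷ʳ x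
  vertex-suc e zero with End.step e 0
  ... | inj₁ child = child
  ... | inj₂ (x , eq) with vertex e 1 | trans (sym (End.start e)) eq
  ...   | []    | ()
  ...   | _ ∷ _ | ()
  vertex-suc e (suc n) with End.step e (suc n)
  ... | inj₁ child = child
  ... | inj₂ (x , eq) = ⊥-elim (m≢1+n+m n {1} (End.simple e
          (sym (∷ʳ-injectiveˡ _ _ (trans (sym eq) (proj₂ (vertex-suc e n)))))))

  length-vertex : ∀ (e : End d) n → length (vertex e n) ≡ n
  length-vertex e zero    = cong length (End.start e)
  length-vertex e (suc n) = trans (cong length (proj₂ (vertex-suc e n)))
    (trans (length-++-≡ (vertex e n) _ (length-vertex e n) refl) (+-comm n 1))

  vertex-agree : ∀ (e e′ : End d) {m n} → m ≤ n →
                 vertex e n ≡ vertex e′ n → vertex e m ≡ vertex e′ m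
  vertex-agree e e′ {m} {n} le eq =
    go (n ∸ m) (subst (λ k → vertex e k ≡ vertex e′ k) (sym (m∸n+n≡m le)) eq)
    where
    go : ∀ k → vertex e (k + m) ≡ vertex e′ (k + m) → vertex e m ≡ vertex e′ m
    go zero    eq = eq
    go (suc k) eq = go k (∷ʳ-injectiveˡ _ _
      (trans (sym (proj₂ (vertex-suc e (k + m)))) (trans eq (proj₂ (vertex-suc e′ (k + m))))))

  record ManyFixed (K n : ℕ) (g : Aut d) : Set where
    field
      at        : Fin K → Word d
      length-at : ∀ i → length (at i) ≡ n
      fixed     : ∀ i → g ⟨ at i ⟩ ≡ at i
      injective : ∀ {i j} → at i ≡ at j → i ≡ j

  -- One representative for each element of π_T(G). Sums over `ω` replace integrals against Haar
  -- measure for quantities decided by level `T`.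
  record Transversal (G : Subgroup d) (T : ℕ) : Set where
    field
      {size}   : ℕ
      ω        : Fin size → Aut d
      ω∈G      : ∀ i → ω i ∈ Member G
      complete : ∀ g → g ∈ Member G → ∃[ i ] Agree T (ω i) g
      distinct : ∀ i j → Agree T (ω i) (ω j) → i ≡ j

-- Counting and finiteness with classical truth values.

module _ (em : ExcludedMiddle 0ℓ) where

  indicator : {P : Set} → Dec P → ℕ
  indicator (yes _) = 1
  indicator (no _)  = 0

  ⟦_⟧ : Set → ℕ
  ⟦ P ⟧ = indicator (em {P})

  ⟦⟧-mono : ∀ {P Q : Set} → (P → Q) → ⟦ P ⟧ ≤ ⟦ Q ⟧
  ⟦⟧-mono {P} {Q} f with em {P} | em {Q}
  ... | no _  | _     = z≤n
  ... | yes _ | yes _ = ≤-refl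
  ... | yes p | no ¬q = ⊥-elim (¬q (f p))

  ⟦⟧-true : ∀ {P : Set} → P → ⟦ P ⟧ ≡ 1
  ⟦⟧-true {P} p with em {P}
  ... | yes _ = refl
  ... | no ¬p = ⊥-elim (¬p p)

  ⟦⟧-false : ∀ {P : Set} → ¬ P → ⟦ P ⟧ ≡ 0
  ⟦⟧-false {P} ¬p with em {P}
  ... | yes p = ⊥-elim (¬p p)
  ... | no _  = refl

  ⟦⟧-× : ∀ {P Q : Set} → ⟦ P × Q ⟧ ≡ ⟦ P ⟧ * ⟦ Q ⟧
  ⟦⟧-× {P} {Q} with em {P} | em {Q}
  ... | yes p | yes q = ⟦⟧-true (p , q)
  ... | yes _ | no ¬q = ⟦⟧-false (λ (_ , q) → ¬q q)
  ... | no ¬p | _     = ⟦⟧-false (λ (p , _) → ¬p p)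

  sum-empty : ∀ {n} (P : Fin n → Set) → (∀ i → ¬ P i) → sum (λ i → ⟦ P i ⟧) ≡ 0
  sum-empty {zero}  P ¬p = refl
  sum-empty {suc n} P ¬p =
    cong₂ _+_ (⟦⟧-false (¬p zero)) (sum-empty (λ i → P (suc i)) (λ i → ¬p (suc i)))

  some≤ : ∀ {n} {P : Set} (Q : Fin n → Set) → (P → ∃ Q) → ⟦ P ⟧ ≤ sum (λ i → ⟦ Q i ⟧)
  some≤ {P = P} Q f with em {P}
  ... | no _  = z≤n
  ... | yes p with i , q ← f p =
    ≤-trans (≤-reflexive (sym (⟦⟧-true q))) (term≤sum (λ i → ⟦ Q i ⟧) i)

  unique≤ : ∀ {n} (P : Fin n → Set) {Q : Set} →
            (∀ i → P i → Q) → (∀ i j → P i → P j → i ≡ j) → sum (λ i → ⟦ P i ⟧) ≤ ⟦ Q ⟧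
  unique≤ {zero}  P imp uni = z≤n
  unique≤ {suc n} P {Q} imp uni with em {P zero}
  ... | no _  = unique≤ (λ i → P (suc i)) (λ i → imp (suc i))
                  (λ i j p q → Fin-suc-injective (uni _ _ p q))
  ... | yes p = ≤-reflexive (trans
                  (cong suc (sum-empty (λ i → P (suc i)) λ i q → Fin-0≢1+n (uni zero (suc i) p q)))
                  (sym (⟦⟧-true (imp zero p))))

  -- Double counting of a relation that is total on P and injective into Q.
  count≤ : ∀ {m n} (P : Fin m → Set) (Q : Fin n → Set) (R : Fin m → Fin n → Set) →
           (∀ i → P i → ∃ (R i)) → (∀ i j → R i j → Q j) →
           (∀ i i′ j → R i j → R i′ j → i ≡ i′) →
           sum (λ i → ⟦ P i ⟧) ≤ sum (λ j → ⟦ Q j ⟧)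
  count≤ P Q R tot into inj = begin
    sum (λ i → ⟦ P i ⟧)                 ≤⟨ sum-mono (λ i → some≤ (R i) (tot i)) ⟩
    sum (λ i → sum (λ j → ⟦ R i j ⟧))   ≡⟨ ∑-comm (λ i j → ⟦ R i j ⟧) ⟩
    sum (λ j → sum (λ i → ⟦ R i j ⟧))
      ≤⟨ sum-mono (λ j → unique≤ (λ i → R i j) (λ i → into i j) (λ i i′ → inj i i′ j)) ⟩
    sum (λ j → ⟦ Q j ⟧)                 ∎
    where open ≤-Reasoning

  injection≤ : ∀ {K n} (Q : Fin n → Set) (e : Fin K → Fin n) →
               (∀ i → Q (e i)) → (∀ {i j} → e i ≡ e j → i ≡ j) → K ≤ sum (λ j → ⟦ Q j ⟧)
  injection≤ {K} Q e q inj = begin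
    K                        ≡⟨ sym (*-identityʳ K) ⟩
    K * 1                    ≡⟨ sym (sum-const K 1) ⟩
    sum {K} (λ _ → 1)        ≤⟨ sum-mono (λ (i : Fin K) → ≤-reflexive (sym (⟦⟧-true tt))) ⟩
    sum {K} (λ _ → ⟦ ⊤ ⟧)    ≤⟨ count≤ {K} (λ _ → ⊤) Q (λ i j → e i ≡ j) (λ i _ → e i , refl)
                                  (λ { i _ refl → q i }) (λ i i′ j p p′ → inj (trans p (sym p′))) ⟩
    sum (λ j → ⟦ Q j ⟧)      ∎
    where open ≤-Reasoning

  module _ (S : Setoid 0ℓ 0ℓ) where
    open Setoid S using (Carrier; _≈_) renaming (refl to ≈-refl; sym to ≈-sym; trans to ≈-trans)

    -- Elements are chosen one by one. If no further choice is possible, those already chosen meet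
    -- every class, and they witness that `S` is finite.
    infinite⇒many : Infinite S → ∀ K →
      Σ[ e ∈ (Fin K → Carrier) ] (∀ i j → e i ≈ e j → i ≡ j)
    infinite⇒many inf zero = (λ ()) , λ ()
    infinite⇒many inf (suc K) with e , inj ← infinite⇒many inf K
                              with em {∃[ x ] (∀ i → ¬ e i ≈ x)}
    ... | yes (x , new) = e′ , inj′
      where
      e′ : Fin (suc K) → Carrier
      e′ zero    = x
      e′ (suc i) = e i

      inj′ : ∀ i j → e′ i ≈ e′ j → i ≡ j
      inj′ zero    zero    _ = refl
      inj′ zero    (suc j) p = ⊥-elim (new j (≈-sym p))
      inj′ (suc i) zero    p = ⊥-elim (new i p)
      inj′ (suc i) (suc j) p = cong suc (inj i j p)
    ... | no ¬new = ⊥-elim (inf (K , record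
        { to        = λ x → proj₁ (index x)
        ; from      = e
        ; to-cong   = λ {x} {y} p → inj _ _ (≈-trans (proj₂ (index x))
                        (≈-trans p (≈-sym (proj₂ (index y)))))
        ; from-cong = λ { refl → ≈-refl }
        ; inverse   = (λ {i} {x} p → inj _ _ (≈-trans (proj₂ (index x)) p))
                    , (λ { {x} refl → proj₂ (index x) })
        }))
      where
      index : ∀ x → ∃[ i ] e i ≈ x
      index x with em {∃[ i ] e i ≈ x}
      ... | yes p = p
      ... | no ¬p = ⊥-elim (¬new (x , λ i q → ¬p (i , q)))

    -- Otherwise there are `suc M` pairwise inequivalent elements, and two of them share a code.
    finite-code : ∀ {M} (c : Carrier → Fin M) → (∀ x y → c x ≡ c y → x ≈ y) → Finite S
    finite-code {M} c inj with em {Finite S}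
    ... | yes fin = fin
    ... | no inf with e , e-inj ← infinite⇒many inf (suc M)
                 with i , j , i<j , eq ← pigeonhole (n<1+n M) (λ i → c (e i)) =
      ⊥-elim (Fin-<⇒≢ i<j (e-inj i j (inj _ _ eq)))

  ⟦⟧≤1 : ∀ {P : Set} → ⟦ P ⟧ ≤ 1
  ⟦⟧≤1 {P} with em {P}
  ... | yes _ = ≤-refl
  ... | no _  = z≤n

  ⟦⟧*sum : ∀ {n} (P : Set) (Q : Fin n → Set) →
           ⟦ P ⟧ * sum (λ i → ⟦ Q i ⟧) ≡ sum (λ i → ⟦ P × Q i ⟧)
  ⟦⟧*sum P Q = trans (*-distribˡ-sum ⟦ P ⟧ (λ i → ⟦ Q i ⟧))
    (sum-cong-≗ (λ i → sym (⟦⟧-× {P} {Q i})))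

  count-mono : ∀ {n} (P Q : Fin n → Set) → (∀ i → P i → Q i) →
               sum (λ i → ⟦ P i ⟧) ≤ sum (λ i → ⟦ Q i ⟧)
  count-mono P Q imp = sum-mono (λ i → ⟦⟧-mono (imp i))

  -- The number of fixed vertices on cosets of level stabilizers.

  module _ {d : ℕ} where

    Fixed : Aut d → Word d → Set
    Fixed g v = g ⟨ v ⟩ ≡ v

    X : ℕ → Aut d → ℕ
    X n g = sum (λ i → ⟦ Fixed g (word n i) ⟧)

    X-zero : ∀ g → X 0 g ≤ 1
    X-zero g = ≤-trans (≤-reflexive (+-identityʳ _)) ⟦⟧≤1

    manyFixed⇒≤X : ∀ {K n g} → ManyFixed K n g → K ≤ X n g
    manyFixed⇒≤X {n = n} {g} many = injection≤ (λ i → Fixed g (word n i))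
      (λ i → code n (at i) (length-at i))
      (λ i → subst (Fixed g) (sym (word-code n _ _)) (fixed i))
      (λ eq → injective (trans (sym (word-code n _ _)) (trans (cong (word n) eq) (word-code n _ _))))
      where open ManyFixed many

    -- Cutting a word after `m` letters gives the pair of indices, and the pair determines the word.
    -- The relation `R` links the three enumerations without comparing their codes.
    X-+ : ∀ m n g →
      X (m + n) g ≤ sum (λ i → sum (λ j → ⟦ Fixed g (word m i ++ word n j) ⟧))
    X-+ m n g = begin
      sum (λ u → ⟦ Fixed g (word (m + n) u) ⟧)
        ≤⟨ sum-mono (λ u → ≤-trans (some≤ (λ i → ∃[ j ] R i j u) (decompose u))
             (sum-mono (λ i → some≤ (λ j → R i j u) (λ r → r)))) ⟩
      sum (λ u → sum (λ i → sum (λ j → ⟦ R i j u ⟧)))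
        ≡⟨ ∑-comm (λ u i → sum (λ j → ⟦ R i j u ⟧)) ⟩
      sum (λ i → sum (λ u → sum (λ j → ⟦ R i j u ⟧)))
        ≤⟨ sum-mono (λ i → ≤-reflexive (∑-comm (λ u j → ⟦ R i j u ⟧))) ⟩
      sum (λ i → sum (λ j → sum (λ u → ⟦ R i j u ⟧)))
        ≤⟨ sum-mono (λ i → sum-mono (λ j → unique≤ (R i j) (λ u (eq , fix) → subst (Fixed g) eq fix)
             (λ u u′ (p , _) (p′ , _) → word-injective (m + n) (trans p (sym p′))))) ⟩
      sum (λ i → sum (λ j → ⟦ Fixed g (word m i ++ word n j) ⟧)) ∎
      where
      open ≤-Reasoning
      R : Fin (d ^ m) → Fin (d ^ n) → Fin (d ^ (m + n)) → Set
      R i j u = word (m + n) u ≡ word m i ++ word n j × Fixed g (word (m + n) u)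

      decompose : ∀ u → Fixed g (word (m + n) u) → ∃[ i ] ∃[ j ] R i j u
      decompose u fix
        with v , w , eq , ∣v∣ , ∣w∣ ←
               split-word {m = m} {n} (word (m + n) u) (length-word (m + n) u) =
        code m v ∣v∣ , code n w ∣w∣ ,
        trans eq (cong₂ _++_ (sym (word-code m v ∣v∣)) (sym (word-code n w ∣w∣))) , fix

    module Sampling .{{_ : NonZero d}} {G : Subgroup d} {T : ℕ} (transversal : Transversal G T) where

      open Transversal transversal

      # : (Aut d → Set) → ℕ
      # P = sum (λ i → ⟦ P (ω i) ⟧)

      #-mono : (P Q : Aut d → Set) → (∀ i → P (ω i) → Q (ω i)) → # P ≤ # Q
      #-mono P Q = count-mono (λ i → P (ω i)) (λ i → Q (ω i))

      Local : (Aut d → Set) → Set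
      Local P = ∀ g h → Agree T g h → P g → P h

      -- Left multiplication by `a` is injective modulo level `T`. The product `a ∙ᴬ ω i` may differ
      -- from its representative `ω j`, and locality of `Q` bridges the two.
      translate : ∀ a → a ∈ Member G → (P Q : Aut d → Set) → Local Q →
                  (∀ i → P (ω i) → Q (a ∙ᴬ ω i)) → # P ≤ # Q
      translate a a∈G P Q local imp = count≤ (λ i → P (ω i)) (λ i → Q (ω i))
        (λ i j → P (ω i) × Agree T (ω j) (a ∙ᴬ ω i))
        (λ i p → let j , ag = complete (a ∙ᴬ ω i) (Subgroup.∙-closed G a∈G (ω∈G i)) in j , p , ag)
        (λ i j (p , ag) → local (a ∙ᴬ ω i) (ω j) (λ v l → sym (ag v l)) (imp i p))
        (λ i i′ j (_ , p) (_ , q) → distinct i i′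
          (λ v l → to-injective a (trans (sym (p v l)) (q v l))))

      agree-local : ∀ {n} g → n ≤ T → Local (Agree n g)
      agree-local g n≤T h h′ ag p v l = trans (p v l) (agree-mono h h′ n≤T ag v l)

      -- Translation by the inverse of `g`; together with `coset-size′` it shows that all cosets of
      -- St_G(n) are equally large.
      coset-size : ∀ {n} g → n ≤ T → g ∈ Member G → # (Agree n g) ≤ # (Agree n idᴬ)
      coset-size g n≤T g∈G = translate (g ⁻¹ᴬ) (Subgroup.⁻¹-closed G g∈G)
        (Agree _ g) (Agree _ idᴬ) (agree-local idᴬ n≤T)
        (λ i p v l → sym (trans (cong (Aut.from g) (sym (p v l))) (from∘to g v)))

      coset-size′ : ∀ {n} g → n ≤ T → g ∈ Member G → # (Agree n idᴬ) ≤ # (Agree n g)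
      coset-size′ g n≤T g∈G = translate g g∈G (Agree _ idᴬ) (Agree _ g) (agree-local g n≤T)
        (λ i p v l → cong (Aut.to g) (p v l))

      stabilizer-nonempty : ∀ {n} → n ≤ T → 1 ≤ # (Agree n idᴬ)
      stabilizer-nonempty {n} n≤T with i , ag ← complete idᴬ (Subgroup.ε-closed G) =
        ≤-trans (≤-reflexive (sym (⟦⟧-true {Agree n idᴬ (ω i)}
          (λ v l → sym (agree-mono (ω i) idᴬ n≤T ag v l)))))
          (term≤sum (λ j → ⟦ Agree n idᴬ (ω j) ⟧) i)

      -- By linearity the sum counts, over all words v w with v of level `n` and w of length `L`,
      -- the coset elements fixing v w. If `g` moves v there are none; otherwise each of the `d ^ L`
      -- words w gets at most a share 1/d^L of the coset. The factor `d ^ L` clears this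
      -- denominator.
      supermartingale :
        (∀ n v w w′ → length v ≡ n → length w ≡ length w′ →
          ∃[ a ] a ∈ LevelStabilizer G n × a ⟨ v ++ w ⟩ ≡ v ++ w′) →
        ∀ n L → n + L ≤ T → ∀ g →
        sum (λ i → ⟦ Agree n g (ω i) ⟧ * X (n + L) (ω i)) ≤ # (Agree n g) * X n g
      supermartingale transitive n L le g = *-cancelˡ-≤ (d ^ L) {{m^n≢0 d L}} (begin
        d ^ L * sum (λ i → ⟦ Agree n g (ω i) ⟧ * X (n + L) (ω i))
          ≤⟨ *-monoʳ-≤ (d ^ L) (sum-mono λ i → *-monoʳ-≤ ⟦ Agree n g (ω i) ⟧ (X-+ n L (ω i))) ⟩
        d ^ L * sum (λ i → ⟦ Agree n g (ω i) ⟧ * sum (λ j → sum (λ k → ⟦ F j k (ω i) ⟧)))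
          ≡⟨ cong (d ^ L *_) (sum-cong-≗ λ i →
               trans (*-distribˡ-sum ⟦ Agree n g (ω i) ⟧ (λ j → sum (λ k → ⟦ F j k (ω i) ⟧)))
                 (sum-cong-≗ λ j → ⟦⟧*sum (Agree n g (ω i)) (λ k → F j k (ω i)))) ⟩
        d ^ L * sum (λ i → sum (λ j → sum (λ k → ⟦ AF j k (ω i) ⟧)))
          ≡⟨ cong (d ^ L *_) (trans (∑-comm (λ i j → sum (λ k → ⟦ AF j k (ω i) ⟧)))
               (sum-cong-≗ λ j → ∑-comm (λ i k → ⟦ AF j k (ω i) ⟧))) ⟩
        d ^ L * sum (λ j → sum (λ k → # (AF j k)))
          ≡⟨ trans (*-distribˡ-sum (d ^ L) (λ j → sum (λ k → # (AF j k))))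
               (sum-cong-≗ λ j → *-distribˡ-sum (d ^ L) (λ k → # (AF j k))) ⟩
        sum (λ j → sum (λ k → d ^ L * # (AF j k)))
          ≤⟨ sum-mono (λ j → sum-mono (λ k → equidistributed j k)) ⟩
        sum {d ^ n} (λ j → sum {d ^ L} (λ k → S * ⟦ Fixed g (word n j) ⟧))
          ≡⟨ sum-cong-≗ (λ j → sum-const (d ^ L) (S * ⟦ Fixed g (word n j) ⟧)) ⟩
        sum (λ j → d ^ L * (S * ⟦ Fixed g (word n j) ⟧))
          ≡⟨ trans (sym (*-distribˡ-sum (d ^ L) (λ j → S * ⟦ Fixed g (word n j) ⟧)))
               (cong (d ^ L *_) (sym (*-distribˡ-sum S (λ j → ⟦ Fixed g (word n j) ⟧)))) ⟩
        d ^ L * (S * X n g) ∎)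
        where
        open ≤-Reasoning
        S = # (Agree n g)

        F AF : Fin (d ^ n) → Fin (d ^ L) → Aut d → Set
        F  j k h = Fixed h (word n j ++ word L k)
        AF j k h = Agree n g h × F j k h

        -- The stabilizer of level n acts transitively on the words v w′ with w′ of
        -- length L, so the image of v w under it is uniform among them.
        equidistributed : ∀ j k → d ^ L * # (AF j k) ≤ S * ⟦ Fixed g (word n j) ⟧
        equidistributed j k with em {Fixed g (word n j)}
        ... | no moved = ≤-reflexive (trans (cong (d ^ L *_)
                (sum-empty (λ i → AF j k (ω i)) λ i (ag , fix) → moved
                (trans (ag v ∣v∣) (agree-prefix (ω i) idᴬ v w fix))))
                (trans (*-zeroʳ (d ^ L)) (sym (*-zeroʳ S))))
          where
          v = word n j
          w = word L k
          ∣v∣ = length-word n j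
        ... | yes _ = begin
          d ^ L * # (AF j k)                         ≡⟨ sym (sum-const (d ^ L) (# (AF j k))) ⟩
          sum {d ^ L} (λ _ → # (AF j k))             ≤⟨ sum-mono move ⟩
          sum (λ l → # (M l))                        ≡⟨ ∑-comm (λ l i → ⟦ M l (ω i) ⟧) ⟩
          sum (λ i → sum (λ l → ⟦ M l (ω i) ⟧))
            ≤⟨ sum-mono (λ i → unique≤ (λ l → M l (ω i)) (λ l → proj₁) (λ l l′ (_ , p) (_ , q) →
                 word-injective L (++-cancelˡ v _ _ (trans (sym p) q)))) ⟩
          S                                          ≡⟨ sym (*-identityʳ S) ⟩
          S * 1                                      ∎
          where
          v = word n j
          w = word L k

          M : Fin (d ^ L) → Aut d → Set
          M l h = Agree n g h × h ⟨ v ++ w ⟩ ≡ v ++ word L l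

          M-local : ∀ l → Local (M l)
          M-local l h h′ ag (p , q) = agree-local g (≤-trans (m≤m+n n L) le) h h′ ag p ,
            trans (sym (agree-mono h h′ le ag _
              (length-++-≡ v w (length-word n j) (length-word L k)))) q

          move : ∀ l → # (AF j k) ≤ # (M l)
          move l with a , (a∈G , a-stab) , a-moves ← transitive n v w (word L l) (length-word n j)
                        (trans (length-word L k) (sym (length-word L l))) =
            translate a a∈G (AF j k) (M l) (M-local l) (λ i (ag , fix) →
              (λ u ∣u∣ → trans (ag u ∣u∣) (sym (a-stab _ (trans (length-to (ω i) u) ∣u∣)))) ,
              trans (cong (Aut.to a) fix) a-moves)

      -- Elements of the coset are sorted by their action on the words below v₀v₁
      -- of length m; each nonempty class is a translate of the class of f.
      large-class : ∀ n k m (B : Aut d → Set) g v₀ v₁ f → f ∈ Member G →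
        length v₀ ≡ n → length v₁ ≡ k → n + (k + m) ≤ T → Agree n g f →
        (∀ h → (∀ w → length w ≡ m → h ⟨ v₀ ++ (v₁ ++ w) ⟩ ≡ f ⟨ v₀ ++ (v₁ ++ w) ⟩) → B h) →
        # (Agree n g) ≤ (d ^ (k + m)) ^ (d ^ m) * # (λ h → Agree n g h × B h)
      large-class n k m B g v₀ v₁ f f∈G ∣v₀∣ ∣v₁∣ le g~f good = begin
        # (Agree n g)
          ≤⟨ sum-mono (λ i → some≤ (λ c → C c i) (λ p → φ i , p , refl)) ⟩
        sum (λ i → sum (λ c → ⟦ C c i ⟧))       ≡⟨ ∑-comm (λ i c → ⟦ C c i ⟧) ⟩
        sum (λ c → sum (λ i → ⟦ C c i ⟧))       ≤⟨ sum-mono class≤ ⟩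
        sum {M} (λ _ → # F)                     ≡⟨ sum-const M (# F) ⟩
        M * # F
          ≤⟨ *-monoʳ-≤ M (#-mono F (λ h → Agree n g h × B h) (λ i (p , q) → p , good (ω i) q)) ⟩
        M * # (λ h → Agree n g h × B h)         ∎
        where
        open ≤-Reasoning
        -- All elements of the coset send `v₀` to the same word, so only the action below it is
        -- recorded: `d ^ m` words, each with an image of length `k + m`. Hence the bound is
        -- independent of `n`.
        M = (d ^ (k + m)) ^ (d ^ m)

        below : Aut d → Word d → Word d
        below h w = section h v₀ ⟨ v₁ ++ w ⟩

        length-below : ∀ h w → length w ≡ m → length (below h w) ≡ k + m
        length-below h w ∣w∣ =
          trans (length-to (section h v₀) (v₁ ++ w)) (length-++-≡ v₁ w ∣v₁∣ ∣w∣)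

        φ : Fin size → Fin M
        φ i = tableCode m (k + m) (below (ω i)) (length-below (ω i))

        C : Fin M → Fin size → Set
        C c i = Agree n g (ω i) × φ i ≡ c

        F : Aut d → Set
        F h = Agree n g h × (∀ w → length w ≡ m → h ⟨ v₀ ++ (v₁ ++ w) ⟩ ≡ f ⟨ v₀ ++ (v₁ ++ w) ⟩)

        F-local : Local F
        F-local h h′ ag (p , q) = agree-local g (≤-trans (m≤m+n n (k + m)) le) h h′ ag p , λ w ∣w∣ →
          trans (sym (agree-mono h h′ le ag _
            (length-++-≡ v₀ _ ∣v₀∣ (length-++-≡ v₁ w ∣v₁∣ ∣w∣)))) (q w ∣w∣)

        class≤ : ∀ c → sum (λ i → ⟦ C c i ⟧) ≤ # F
        class≤ c with em {∃ (C c)}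
        ... | no empty = ≤-trans (≤-reflexive (sum-empty (C c) (λ i p → empty (i , p)))) z≤n
        ... | yes (i₀ , g~h₀ , φi₀≡c) =
          ≤-trans (count-mono (C c) (λ i → C′ (ω i)) (λ i (p , q) → p , below≡ i q))
            (translate (f ∙ᴬ h₀ ⁻¹ᴬ) (Subgroup.∙-closed G f∈G (Subgroup.⁻¹-closed G (ω∈G i₀)))
              C′ F F-local move)
          where
          h₀ = ω i₀

          C′ : Aut d → Set
          C′ h = Agree n g h × (∀ w → length w ≡ m → below h w ≡ below h₀ w)

          below≡ : ∀ i → φ i ≡ c → ∀ w → length w ≡ m → below (ω i) w ≡ below h₀ w
          below≡ i eq = tableCode-injective m (k + m) (below (ω i)) (below h₀)
            (length-below (ω i)) (length-below h₀) (trans eq (sym φi₀≡c))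

          move : ∀ i → C′ (ω i) → F (f ∙ᴬ h₀ ⁻¹ᴬ ∙ᴬ ω i)
          move i (g~h , same) =
            (λ u ∣u∣ → trans (g~f u ∣u∣) (sym (shift u (trans (sym (g~h u ∣u∣)) (g~h₀ u ∣u∣))))) ,
            (λ w ∣w∣ → shift (v₀ ++ (v₁ ++ w)) (trans (section-++ (ω i) v₀ (v₁ ++ w))
              (trans (cong₂ _++_ (trans (sym (g~h v₀ ∣v₀∣)) (g~h₀ v₀ ∣v₀∣)) (same w ∣w∣))
                (sym (section-++ h₀ v₀ (v₁ ++ w))))))
            where
            -- Wherever an element agrees with `h₀`, its translate agrees with `f`.
            shift : ∀ u → ω i ⟨ u ⟩ ≡ h₀ ⟨ u ⟩ → (f ∙ᴬ h₀ ⁻¹ᴬ ∙ᴬ ω i) ⟨ u ⟩ ≡ f ⟨ u ⟩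
            shift u eq = cong (Aut.to f) (trans (cong (Aut.from h₀) eq) (from∘to h₀ u))

      -- Decay of the survival probability.

      Alive : Aut d → Set
      Alive = FixesVertexAtLevel T

      module _ (K L M′ : ℕ)
        (expectation : ∀ n → n + L ≤ T → ∀ g →
          sum (λ i → ⟦ Agree n g (ω i) ⟧ * X (n + L) (ω i)) ≤ # (Agree n g) * X n g)
        (growth : ∀ n → n + L ≤ T → ∀ g → (∃[ i ] Agree n g (ω i) × Alive (ω i)) →
          # (Agree n g) ≤ M′ * # (λ h → Agree n g h × K ≤ X (n + L) h)) where

        -- Every element of the coset of g is counted # (Agree (n + L) idᴬ) times on
        -- the right, which avoids choosing representatives of the subcosets.
        subdivide : ∀ n → n + L ≤ T → ∀ g →
          # (Agree (n + L) idᴬ) * # (λ h → Agree n g h × Alive h) ≤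
          sum (λ i → ⟦ Agree n g (ω i) ⟧ * # (λ h → Agree (n + L) (ω i) h × Alive h))
        subdivide n le g = begin
          S′ * # B                                ≡⟨ *-distribˡ-sum S′ (λ j → ⟦ B (ω j) ⟧) ⟩
          sum (λ j → S′ * ⟦ B (ω j) ⟧)
            ≤⟨ sum-mono (λ j → ≤-trans (≤-reflexive (*-comm S′ ⟦ B (ω j) ⟧))
                 (*-monoʳ-≤ ⟦ B (ω j) ⟧ (coset-size′ (ω j) le (ω∈G j)))) ⟩
          sum (λ j → ⟦ B (ω j) ⟧ * # (Agree (n + L) (ω j)))
            ≡⟨ sum-cong-≗ (λ j → ⟦⟧*sum (B (ω j)) (λ i → Agree (n + L) (ω j) (ω i))) ⟩
          sum (λ j → sum (λ i → ⟦ B (ω j) × Agree (n + L) (ω j) (ω i) ⟧))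
            ≡⟨ ∑-comm (λ j i → ⟦ B (ω j) × Agree (n + L) (ω j) (ω i) ⟧) ⟩
          sum (λ i → sum (λ j → ⟦ B (ω j) × Agree (n + L) (ω j) (ω i) ⟧))
            ≤⟨ sum-mono (λ i → count-mono (λ j → B (ω j) × Agree (n + L) (ω j) (ω i))
                 (λ j → Agree n g (ω i) × Agree (n + L) (ω i) (ω j) × Alive (ω j))
                 (λ j ((p , alive) , q) →
                   (λ v l → trans (p v l) (agree-mono (ω j) (ω i) (m≤m+n n L) q v l)) ,
                   (λ v l → sym (q v l)) , alive)) ⟩
          sum (λ i → sum (λ j → ⟦ Agree n g (ω i) × Agree (n + L) (ω i) (ω j) × Alive (ω j) ⟧))
            ≡⟨ sum-cong-≗ (λ i → sym (⟦⟧*sum (Agree n g (ω i))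
                 (λ j → Agree (n + L) (ω i) (ω j) × Alive (ω j)))) ⟩
          sum (λ i → ⟦ Agree n g (ω i) ⟧ * # (λ h → Agree (n + L) (ω i) h × Alive h)) ∎
          where
          open ≤-Reasoning
          S′ = # (Agree (n + L) idᴬ)

          B : Aut d → Set
          B h = Agree n g h × Alive h

        -- `growth` bounds the complementary event `K ≤ X` from below, and `complement-bound` turns
        -- this into the factor M′/(M′ + 1).
        small : ∀ n → n + L ≤ T → ∀ g → (∃[ i ] Agree n g (ω i) × Alive (ω i)) →
          suc M′ * sum (λ i → ⟦ Agree n g (ω i) ⟧ * ⟦ X (n + L) (ω i) < K ⟧) ≤ M′ * # (Agree n g)
        small n le g alive = complement-bound M′ {c = # (λ h → Agree n g h × K ≤ X (n + L) h)}
          (begin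
            sum lt + sum ge          ≡⟨ sym (∑-distrib-+ lt ge) ⟩
            sum (λ i → lt i + ge i)
              ≤⟨ sum-mono (λ i → split (Agree n g (ω i)) (X (n + L) (ω i))) ⟩
            # (Agree n g) ∎)
          (growth n le g alive)
          where
          open ≤-Reasoning
          lt ge : Fin size → ℕ
          lt i = ⟦ Agree n g (ω i) ⟧ * ⟦ X (n + L) (ω i) < K ⟧
          ge i = ⟦ Agree n g (ω i) × K ≤ X (n + L) (ω i) ⟧

          split : ∀ P x → ⟦ P ⟧ * ⟦ x < K ⟧ + ⟦ P × K ≤ x ⟧ ≤ ⟦ P ⟧
          split P x with K ≤? x
          ... | yes K≤x rewrite ⟦⟧-false {x < K} (≤⇒≯ K≤x) | *-zeroʳ ⟦ P ⟧ = ⟦⟧-mono proj₁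
          ... | no K≰x rewrite ⟦⟧-true {x < K} (≰⇒> K≰x)
                             | ⟦⟧-false {P × K ≤ x} (λ (_ , le) → K≰x le) =
            ≤-reflexive (trans (+-identityʳ _) (*-identityʳ _))

        -- The probability bound with denominators cleared, where M is `suc M′`. If `K ≤ X n g`, the
        -- term X/K alone is at least 1. Otherwise the induction hypothesis is averaged over the
        -- subcosets of level `n + L`: `small` gains a factor 1 - 1/M in the first term, and
        -- `expectation` keeps the second from growing.
        decay : ∀ k n → n + k * L ≤ T → ∀ g → g ∈ Member G →
          K * suc M′ ^ k * # (λ h → Agree n g h × Alive h) ≤
          # (Agree n g) * (K * M′ ^ k * ⟦ X n g < K ⟧ + suc M′ ^ k * X n g)
        decay k n le g g∈G with K ≤? X n g
        decay k n le g g∈G | yes K≤X = begin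
          K * M ^ k * A                             ≤⟨ *-mono-≤ (*-monoˡ-≤ (M ^ k) K≤X) A≤S ⟩
          X n g * M ^ k * S                         ≡⟨ swap-factors (X n g) (M ^ k) S ⟩
          S * (M ^ k * X n g)                       ≤⟨ *-monoʳ-≤ S (m≤n+m _ _) ⟩
          S * (K * M′ ^ k * ⟦ X n g < K ⟧ + M ^ k * X n g) ∎
          where
          open ≤-Reasoning
          M = suc M′
          A = # (λ h → Agree n g h × Alive h)
          S = # (Agree n g)
          A≤S : A ≤ S
          A≤S = #-mono (λ h → Agree n g h × Alive h) (Agree n g) (λ _ → proj₁)
        decay zero n le g g∈G | no K≰X rewrite ⟦⟧-true {X n g < K} (≰⇒> K≰X) = begin
          K * 1 * A                                 ≤⟨ *-monoʳ-≤ (K * 1) A≤S ⟩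
          K * 1 * S                                 ≡⟨ *-comm (K * 1) S ⟩
          S * (K * 1)
            ≤⟨ *-monoʳ-≤ S (≤-trans (≤-reflexive (sym (*-identityʳ (K * 1)))) (m≤m+n _ _)) ⟩
          S * (K * 1 * 1 + 1 * X n g)               ∎
          where
          open ≤-Reasoning
          A = # (λ h → Agree n g h × Alive h)
          S = # (Agree n g)
          A≤S : A ≤ S
          A≤S = #-mono (λ h → Agree n g h × Alive h) (Agree n g) (λ _ → proj₁)
        decay (suc k) n le g g∈G | no K≰X with em {∃[ i ] Agree n g (ω i) × Alive (ω i)}
        -- `growth` speaks only of cosets with a surviving element; in any other the count is zero.
        ... | no dead = ≤-trans (≤-reflexive (trans
                (cong (K * suc M′ ^ suc k *_)
                  (sum-empty (λ i → Agree n g (ω i) × Alive (ω i)) (λ i p → dead (i , p))))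
                (*-zeroʳ (K * suc M′ ^ suc k)))) z≤n
        ... | yes alive rewrite ⟦⟧-true {X n g < K} (≰⇒> K≰X) =
          -- `S′` is the common size of the subcosets, the multiplicity with which `subdivide`
          -- counts; it is positive and cancels at the end.
          *-cancelˡ-≤ S′ {{>-nonZero (stabilizer-nonempty n+L≤T)}} (begin
          S′ * (K * (M * P) * A)                           ≡⟨ scale S′ K M P A ⟩
          M * (K * P * (S′ * A))
            ≤⟨ *-monoʳ-≤ M (*-monoʳ-≤ (K * P) (subdivide n n+L≤T g)) ⟩
          M * (K * P * sum (λ i → a i * A′ i))
            ≡⟨ cong (M *_) (trans (*-distribˡ-sum (K * P) (λ i → a i * A′ i))
                 (sum-cong-≗ (λ i → exchange (K * P) (a i) (A′ i)))) ⟩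
          M * sum (λ i → a i * (K * P * A′ i))
            ≤⟨ *-monoʳ-≤ M (sum-mono (λ i → *-monoʳ-≤ (a i) (later i))) ⟩
          M * sum (λ i → a i * (S′ * (K * Q * b i + P * x i)))
            ≡⟨ cong (M *_) (trans (sum-cong-≗ (λ i → spread (a i) S′ (K * Q) (b i) P (x i)))
                 (trans (∑-distrib-+ (λ i → S′ * (K * Q) * (a i * b i)) (λ i → S′ * P * (a i * x i)))
                   (sym (cong₂ _+_ (*-distribˡ-sum (S′ * (K * Q)) (λ i → a i * b i))
                                   (*-distribˡ-sum (S′ * P) (λ i → a i * x i)))))) ⟩
          M * (S′ * (K * Q) * sum (λ i → a i * b i) + S′ * P * sum (λ i → a i * x i))
            ≡⟨ collect M S′ K Q (sum (λ i → a i * b i)) P (sum (λ i → a i * x i)) ⟩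
          S′ * (K * Q * (M * sum (λ i → a i * b i)) + M * P * sum (λ i → a i * x i))
            ≤⟨ *-monoʳ-≤ S′ (+-mono-≤ (*-monoʳ-≤ (K * Q) (small n n+L≤T g alive))
                                      (*-monoʳ-≤ (M * P) (expectation n n+L≤T g))) ⟩
          S′ * (K * Q * (M′ * S) + M * P * (S * X n g))    ≡⟨ factor S′ K Q M′ S M P (X n g) ⟩
          S′ * (S * (K * (M′ * Q) * 1 + M * P * X n g))    ∎)
          where
          open ≤-Reasoning
          M = suc M′
          P = M ^ k
          Q = M′ ^ k
          A = # (λ h → Agree n g h × Alive h)
          S = # (Agree n g)
          S′ = # (Agree (n + L) idᴬ)
          a A′ b x : Fin size → ℕ
          a i = ⟦ Agree n g (ω i) ⟧
          A′ i = # (λ h → Agree (n + L) (ω i) h × Alive h)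
          b i = ⟦ X (n + L) (ω i) < K ⟧
          x i = X (n + L) (ω i)

          le′ : n + L + k * L ≤ T
          le′ = ≤-trans (≤-reflexive (+-assoc n L (k * L))) le

          n+L≤T : n + L ≤ T
          n+L≤T = ≤-trans (m≤m+n (n + L) (k * L)) le′

          later : ∀ i → K * P * A′ i ≤ S′ * (K * Q * b i + P * x i)
          later i = ≤-trans (decay k (n + L) le′ (ω i) (ω∈G i))
            (*-monoˡ-≤ (K * Q * b i + P * x i) (coset-size (ω i) n+L≤T (ω∈G i)))

  -- From fixed ends to fixed vertices, and finiteness of the quotients.

  module _ {d : ℕ} where

    -- Ends that differ at some level differ at all later ones. An arbitrary conclusion `P` also
    -- covers equal ends, so that all pairs of indices can be treated alike with `i ≡ j` for `P`.
    separated : ∀ {P : Set} (x y : End d) → (Setoid._≈_ (ends d) x y → P) →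
      ∃[ m₀ ] (∀ m → m₀ ≤ m → vertex x m ≡ vertex y m → P)
    separated x y f with em {∃[ n ] ¬ vertex x n ≡ vertex y n}
    ... | yes (n , x≢y) = n , λ m le eq → ⊥-elim (x≢y (vertex-agree x y le eq))
    ... | no never = 0 , λ _ _ _ → f (λ n → decidable-stable em (λ x≢y → never (n , x≢y)))

    -- Finitely many distinct ends pass through distinct vertices from some level on. Having this at
    -- all later levels allows one common level for several elements.
    infinite⇒manyFixed : ∀ (s : Aut d) → FixesInfinitelyManyEnds s → ∀ K →
      ∃[ m₀ ] (∀ m → m₀ ≤ m → ManyFixed K m s)
    infinite⇒manyFixed s inf K
      with e , inj ← infinite⇒many (fixedEnds s) inf K
      with m₀ , sep ← eventually-all _ (λ i → eventually-all _ (λ j →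
             separated (proj₁ (e i)) (proj₁ (e j)) (inj i j))) =
      m₀ , λ m le → record
        { at        = λ i → vertex (proj₁ (e i)) m
        ; length-at = λ i → length-vertex (proj₁ (e i)) m
        ; fixed     = λ i → proj₂ (e i) m
        ; injective = λ {i} {j} → sep m le i j
        }

    module _ .{{_ : NonZero d}} where

      finite-π : ∀ n (P : Pred (Aut d) 0ℓ) → Finite (π n P)
      finite-π n P = finite-code (π n P)
        (λ (g , _) → tableCode n n (Aut.to g) (length-at g))
        (λ (g , _) (h , _) eq → agree-≤ g h
          (tableCode-injective n n (Aut.to g) (Aut.to h) (length-at g) (length-at h) eq))
        where
        length-at : ∀ (g : Aut d) w → length w ≡ n → length (g ⟨ w ⟩) ≡ n
        length-at g w ∣w∣ = trans (length-to g w) ∣w∣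

      -- Martingale virtually mixing groups.

      module _ (G : Subgroup d) (martingale : Martingale G) (mix : VirtuallyMixing G)
        (cosetEnds : ∀ g → g ∈ Member G →
          ∃[ s ] s ∈ LeftCoset (VirtuallyMixing.mixingSubgroup mix) g × FixesInfinitelyManyEnds s)
        where

        open VirtuallyMixing mix renaming (mixingSubgroup to H)
        open MixingSubgroup isMixingSubgroup
        open Fractal fractal

        -- The martingale condition begins at level 1. At level 0 the stabilizer is `G` itself, and
        -- level transitivity takes over.
        stabilizer-transitive : ∀ n v w w′ → length v ≡ n → length w ≡ length w′ →
          ∃[ a ] a ∈ LevelStabilizer G n × a ⟨ v ++ w ⟩ ≡ v ++ w′
        stabilizer-transitive zero [] w w′ _ eq with a , a∈G , p ← levelTransitive w w′ eq =
          a , (a∈G , λ { [] _ → Aut.root a }) , p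
        stabilizer-transitive (suc n) v w w′ ∣v∣ eq = martingale (suc n) v (s≤s z≤n) ∣v∣ w w′ eq

        -- One more level of delay covers n = 0, which the mixing condition excludes.
        mixing₀ : ∀ n v {k} → n + suc delay ≤ length v → k ∈ Member H →
                  k ∈ SectionsAt (LevelStabilizer G n) v
        mixing₀ n v le k∈H
          with h , (h∈G , stab) , rest ← mixing (suc n) v (s≤s z≤n)
                 (≤-trans (≤-reflexive (sym (+-suc n delay))) le) k∈H =
          h , (h∈G , agree-mono h idᴬ (n≤1+n n) stab) , rest

        -- One element with infinitely many fixed ends is taken in each of the finitely many cosets;
        -- `m` is a common threshold for them.
        uniform-level : ∀ K →
          ∃[ m ] (∀ g → g ∈ Member G → ∃[ s ] s ∈ LeftCoset H g × ManyFixed K m s)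
        uniform-level K
          with r , inv ← finiteIndex
          with m , many ← eventually-all
            (λ i m → ManyFixed K m
              (proj₁ (cosetEnds (proj₁ (Inverse.from inv i)) (proj₂ (Inverse.from inv i)))))
            (λ i → infinite⇒manyFixed _ (proj₂ (proj₂ (cosetEnds _ (proj₂ (Inverse.from inv i))))) K) =
          m , λ g g∈G →
            let i = Inverse.to inv (g , g∈G)
                a , a∈G = Inverse.from inv i
                s , s∈aH , _ = cosetEnds a a∈G
                s∈G = Subgroup.respects G (λ v → to∘from a (s ⟨ v ⟩))
                        (Subgroup.∙-closed G a∈G (subgroup s∈aH))
            -- `a` is the listed representative of the coset of `g`, so an element chosen for `a`
            -- also lies in that coset.
            in s , Setoid.trans (cosets G H) {g , g∈G} {a , a∈G} {s , s∈G}
                     (Setoid.sym (cosets G H) {a , a∈G} {g , g∈G}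
                       (Inverse.inverseʳ inv {g , g∈G} refl))
                     s∈aH
                 , many m ≤-refl i

        module _ {T : ℕ} (transversal : Transversal G T) where

          open Transversal transversal
          open Sampling transversal

          -- A survivor h₀ fixes some v at level `n + suc delay`. For `s` in the H-coset of its
          -- section at v, the quotient of that section and `s` lies in H, so mixing realises it as
          -- the section of some h₁ in St_G(n) fixing v. Then `h₀ ∙ᴬ h₁` stays in the coset and has
          -- section `s` at v. Elements acting like it below v fix the same `K` vertices, and
          -- `large-class` counts them.
          growth : ∀ K m → (∀ g → g ∈ Member G → ∃[ s ] s ∈ LeftCoset H g × ManyFixed K m s) →
            ∀ n → n + (suc delay + m) ≤ T → ∀ g → (∃[ i ] Agree n g (ω i) × Alive (ω i)) →
            # (Agree n g) ≤ (d ^ (suc delay + m)) ^ (d ^ m) *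
              # (λ h → Agree n g h × K ≤ X (n + (suc delay + m)) h)
          growth K m many n le g (i , g~h₀ , alive)
            with u , ∣v∣ , fix ← fixes-mono (ω i)
                   (≤-trans (+-monoʳ-≤ n (m≤m+n (suc delay) m)) le) alive
            with v₀ , v₁ , refl , ∣v₀∣ , ∣v₁∣ ← split-word {m = n} {suc delay} u ∣v∣
            with s , s∈ , manyFixed ←
                   many (section (ω i) (v₀ ++ v₁)) (selfSimilar (ω∈G i) (v₀ ++ v₁))
            with h₁ , (h₁∈G , stab) , fix₁ , sec ← mixing₀ n (v₀ ++ v₁) (≤-reflexive (sym ∣v∣)) s∈ =
            large-class n (suc delay) m (λ h → K ≤ X (n + (suc delay + m)) h) g v₀ v₁ f
              (Subgroup.∙-closed G (ω∈G i) h₁∈G) ∣v₀∣ ∣v₁∣ le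
              (λ u ∣u∣ → trans (g~h₀ u ∣u∣) (sym (cong (Aut.to (ω i)) (stab u ∣u∣))))
              (λ h same → manyFixed⇒≤X {g = h} (record
                { at        = λ j → v₀ ++ (v₁ ++ at j)
                ; length-at = λ j → length-++-≡ v₀ (v₁ ++ at j) ∣v₀∣
                                        (length-++-≡ v₁ (at j) ∣v₁∣ (length-at j))
                ; fixed     = λ j → trans (same (at j) (length-at j)) (f-fixes j)
                ; injective = λ {j} {j′} eq →
                    injective (++-cancelˡ v₁ (at j) (at j′) (++-cancelˡ v₀ _ _ eq))
                }))
            where
            open ManyFixed manyFixed
            v = v₀ ++ v₁
            h₀ = ω i
            f = h₀ ∙ᴬ h₁

            f-section : ∀ w → f ⟨ v ++ w ⟩ ≡ v ++ s ⟨ w ⟩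
            f-section w = begin
              h₀ ⟨ h₁ ⟨ v ++ w ⟩ ⟩            ≡⟨ cong (Aut.to h₀) (section-++ h₁ v w) ⟩
              h₀ ⟨ h₁ ⟨ v ⟩ ++ section h₁ v ⟨ w ⟩ ⟩
                ≡⟨ cong (Aut.to h₀) (cong₂ _++_ fix₁ (sec w)) ⟩
              h₀ ⟨ v ++ Aut.from (section h₀ v) (s ⟨ w ⟩) ⟩
                ≡⟨ section-++ h₀ v _ ⟩
              h₀ ⟨ v ⟩ ++ section h₀ v ⟨ Aut.from (section h₀ v) (s ⟨ w ⟩) ⟩
                ≡⟨ cong₂ _++_ fix (to∘from (section h₀ v) (s ⟨ w ⟩)) ⟩
              v ++ s ⟨ w ⟩ ∎
              where open ≡-Reasoning

            f-fixes : ∀ j → f ⟨ v₀ ++ (v₁ ++ at j) ⟩ ≡ v₀ ++ (v₁ ++ at j)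
            f-fixes j = subst (Fixed f) (++-assoc v₀ v₁ (at j))
              (trans (f-section (at j)) (cong (v ++_) (fixed j)))

        -- The bound at each level and the limit.

        module _ (n : ℕ) where

          π-total : Finite (π n (Member G))
          π-total = finite-π n (Member G)

          π-fixing : Finite (π n (Member G ∩ FixesVertexAtLevel n))
          π-fixing = finite-π n (Member G ∩ FixesVertexAtLevel n)

          fixing total : ℕ
          fixing = proj₁ π-fixing
          total  = proj₁ π-total

          total-nonZero : NonZero total
          total-nonZero = nonZeroIndex (Inverse.to (proj₂ π-total) (idᴬ , Subgroup.ε-closed G))

          private
            module I = Inverse (proj₂ π-total)
            module J = Inverse (proj₂ π-fixing)

          transversal : Transversal G n
          transversal = record
            { ω        = λ i → proj₁ (I.from i)
            ; ω∈G      = λ i → proj₂ (I.from i)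
            ; complete = λ g g∈G → I.to (g , g∈G) , λ v ∣v∣ →
                I.strictlyInverseʳ (g , g∈G) v (≤-reflexive ∣v∣)
            ; distinct = λ i j ag → trans (sym (I.strictlyInverseˡ i))
                (trans (I.to-cong {I.from i} {I.from j}
                  (agree-≤ (proj₁ (I.from i)) (proj₁ (I.from j)) ag))
                  (I.strictlyInverseˡ j))
            }

          open Transversal transversal hiding (size)
          open Sampling transversal

          ω-to : ∀ x → Agree n (ω (I.to x)) (proj₁ x)
          ω-to (g , g∈G) = proj₂ (complete g g∈G)

          -- Level 0 is the root alone, so `Agree 0 idᴬ` holds throughout; it gives the count the
          -- form treated by `decay`.
          fixing≤ : fixing ≤ # (λ h → Agree 0 idᴬ h × Alive h)
          fixing≤ = injection≤ (λ i → Agree 0 idᴬ (ω i) × Alive (ω i)) class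
            (λ j → (λ { [] _ → sym (Aut.root (ω (class j))) }) , alive j)
            (λ {j} {j′} eq → trans (sym (J.strictlyInverseˡ j)) (trans
              (J.to-cong {J.from j} {J.from j′} (agree-≤ (proj₁ (J.from j)) (proj₁ (J.from j′)) λ v l →
                trans (sym (ω-to (element j) v l))
                  (trans (cong (λ i → ω i ⟨ v ⟩) eq) (ω-to (element j′) v l))))
              (J.strictlyInverseˡ j′)))
            where
            element : Fin fixing → ∃ (Member G)
            element j = let g , g∈G , _ = J.from j in g , g∈G

            class : Fin fixing → Fin total
            class j = I.to (element j)

            alive : ∀ j → Alive (ω (class j))
            alive j = let _ , _ , v , ∣v∣ , fix = J.from j in
              v , ∣v∣ , trans (ω-to (element j) v ∣v∣) fix

          -- `decay` is applied from the root with k = K * M rounds. By `geometric` the first term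
          -- is then at most 1/K, and so is the second, since `X 0` is at most 1; this accounts for
          -- the factor 2.
          fixing-bound : ∀ K m →
            (∀ g → g ∈ Member G → ∃[ s ] s ∈ LeftCoset H g × ManyFixed K m s) →
            let L = suc delay + m ; M = (d ^ L) ^ (d ^ m) in
            K * M * L ≤ n → K * fixing ≤ 2 * total
          fixing-bound K m many le = *-cancelˡ-≤ P {{m^n≢0 (suc M) k}} (begin
            P * (K * fixing)                              ≡⟨ reorder P K fixing ⟩
            K * P * fixing                                ≤⟨ *-monoʳ-≤ (K * P) fixing≤ ⟩
            K * P * # (λ h → Agree 0 idᴬ h × Alive h)
              ≤⟨ decay K L M (λ n′ → supermartingale stabilizer-transitive n′ L)
                   (growth transversal K m many)
                   k 0 le idᴬ (Subgroup.ε-closed G) ⟩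
            # (Agree 0 idᴬ) * (K * M ^ k * ⟦ X 0 idᴬ < K ⟧ + P * X 0 idᴬ)
              ≤⟨ *-mono-≤ S≤total (+-mono-≤ (*-mono-≤ (geometric K M) ⟦⟧≤1) (*-monoʳ-≤ P (X-zero idᴬ))) ⟩
            total * (P * 1 + P * 1)                       ≡⟨ double total P ⟩
            P * (2 * total)                               ∎)
            where
            open ≤-Reasoning
            L = suc delay + m
            M = (d ^ L) ^ (d ^ m)
            k = K * M
            P = suc M ^ k

            instance
              M-nonZero : NonZero M
              M-nonZero = m^n≢0 (d ^ L) (d ^ m) {{m^n≢0 d L}}

            S≤total : # (Agree 0 idᴬ) ≤ total
            S≤total = ≤-trans (sum-mono {f = λ i → ⟦ Agree 0 idᴬ (ω i) ⟧} {g = λ _ → 1} (λ i → ⟦⟧≤1))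
              (≤-reflexive (trans (sum-const total 1) (*-identityʳ total)))

            reorder : ∀ p k f → p * (k * f) ≡ k * p * f
            reorder = solve-∀

            double : ∀ t p → t * (p * 1 + p * 1) ≡ p * (2 * t)
            double = solve-∀

        fixing-vanishes : ∀ K → ∃[ N ] (∀ n → N ≤ n → K * fixing n ≤ 2 * total n)
        fixing-vanishes K = let m , many = uniform-level K in
          let L = suc delay + m in
          K * (d ^ L) ^ (d ^ m) * L , λ n le → fixing-bound n K m many le

        proportion : ℕ → ℚ
        proportion n = ((ℤ.+ fixing n) ℚ./ total n) {{total-nonZero n}}

        proportion-fixing : ∀ n → FixingProportion G n (proportion n)
        proportion-fixing n = record
          { fixing        = fixing n
          ; total         = total n
          ; total-nonZero = total-nonZero n
          ; fixing-card   = proj₂ (π-fixing n)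
          ; total-card    = proj₂ (π-total n)
          ; proportion    = refl
          }

        proportion→0 : Converges proportion 0ℚ
        -- With this K the bound 2/K is half the reciprocal of the denominator of `ε`.
        proportion→0 ε 0<ε = let N , bound = fixing-vanishes (4 * ℚ.denominatorℕ ε) in
          N , λ n le → fraction-small (fixing n) (total n) {{total-nonZero n}} ε 0<ε (bound n le)

        hasFPP : HasFPP G 0ℚ
        hasFPP = proportion , proportion-fixing , proportion→0

theorem6 : ExcludedMiddle 0ℓ →
  (d : ℕ) → 2 ≤ d →
  (G : Subgroup d) → Martingale G →
  (mix : VirtuallyMixing G) →
  (∀ g → g ∈ Member G →
    ∃[ s ] s ∈ LeftCoset (VirtuallyMixing.mixingSubgroup mix) g × FixesInfinitelyManyEnds s) →
  HasFPP G 0ℚ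
theorem6 em d 2≤d G martingale mix cosetEnds =
  hasFPP em G martingale mix cosetEnds
  where
  instance
    d-nonZero : NonZero d
    d-nonZero = >-nonZero (≤-trans (n≤1+n 1) 2≤d)
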